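{- Let $A$ and $B$ be sets. There is a bijection between the homset $\mathrm{St}(\mathbf{Set})([A],[B])$ and the set of causal functions from $A^{\mathbb N}$ to $B^{\mathbb N}$, where $[A]=(A,A,\dots)$ and $[B]=(B,B,\dots)$ are constant sequences of sets.
   Context: Causal functions: for $\mathbf x,\mathbf y\in A^{\mathbb N}$ write $\mathbf x\equiv_n\mathbf y$ if $\mathbf x_i=\mathbf y_i$ for all $i\le n$. A function $f:A^{\mathbb N}\to B^{\mathbb N}$ is causal if for all $\mathbf x,\mathbf y\in A^{\mathbb N}$ and all $n\in\mathbb N$, $\mathbf x\equiv_n\mathbf y$ implies $f(\mathbf x)\equiv_n f(\mathbf y)$. The category $\mathrm{St}(\mathbb C)$, for a Cartesian category $\mathbb C$ (with chosen finite products, treated as strict, i.e. products strictly associative and unital, by replacing $\mathbb C$ with an equivalent strictification; here $\mathbb C=\mathbf{Set}$). Products are $\times$, the terminal object is $1$, $!_X:X\to 1$. Equations between morphisms are written with generalized elements. 2-cells: a 2-cell $f$ consists of objects $S=\mathrm{prv}\,f$, $X=\mathrm{dom}\,f$, $S'=\mathrm{nxt}\,f$, $Y=\mathrm{cod}\,f$ together with an underlying morphism $Uf:S\times X\to S'\times Y$ in $\mathbb C$ ($S,S'$ are state types, $X,Y$ value types). Horizontal composition: if also $g$ has underlying morphism $Ug:T\times Y\to T'\times Z$, then $g*f$ has $\mathrm{prv}=S\times T$, $\mathrm{dom}=X$, $\mathrm{nxt}=S'\times T'$, $\mathrm{cod}=Z$ and $U(g*f)(s,t,x)=(s',t',z)$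 where $(s',y)=Uf(s,x)$, $(t',z)=Ug(t,y)$. Vertical composition: if $h$ has $Uh:S'\times V\to S''\times W$, then $f;h$ has $\mathrm{prv}=S$, $\mathrm{dom}=X\times V$, $\mathrm{nxt}=S''$, $\mathrm{cod}=Y\times W$ and $U(f;h)(s,x,v)=(s'',y,w)$ where $(s',y)=Uf(s,x)$, $(s'',w)=Uh(s',v)$. For $\phi:X\to Y$ in $\mathbb C$, $\phi^h$ is the 2-cell with underlying morphism $\phi$, $\mathrm{prv}=\mathrm{nxt}=1$, $\mathrm{dom}=X$, $\mathrm{cod}=Y$; $\phi^v$ is the 2-cell with underlying morphism $\phi$, $\mathrm{prv}=X$, $\mathrm{nxt}=Y$, $\mathrm{dom}=\mathrm{cod}=1$. Stateful morphism sequences: for $\mathbf X,\mathbf Y\in|\mathbb C|^{\mathbb N}$, a stateful morphism sequence $(i,\mathbf s):\mathbf X\to\mathbf Y$ is a sequence $\mathbf s=(\mathbf s_k)_{k\in\mathbb N}$ of 2-cells with $\mathrm{dom}\,\mathbf s_k=\mathbf X_k$, $\mathrm{cod}\,\mathbf s_k=\mathbf Y_k$, $\mathrm{nxt}\,\mathbf s_k=\mathrm{prv}\,\mathbf s_{k+1}$ for all $k$, and a morphism $i:1\to\mathrm{prv}\,\mathbf s_0$. Its $n$th truncation is $\mathrm{Tc}_n(i,\mathbf s)=U(i^v;\mathbf s_0;\cdots;\mathbf s_n;(!_{\mathrm{nxt}\,\mathbf s_n})^v):\prod_{k=0}^n\mathbf X_k\to\prod_{k=0}^n\mathbf Y_k$.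 Two stateful morphism sequences $\mathbf X\to\mathbf Y$ are extensionally equal if their $n$th truncations agree for all $n\in\mathbb N$. $\mathrm{St}(\mathbb C)$ has objects $|\mathbb C|^{\mathbb N}$ and morphisms the extensional equivalence classes of stateful morphism sequences. Identity on $\mathbf X$: $(\mathrm{id}_1,[(\mathrm{id}_{\mathbf X_k})^h]_k)$. Composition of $(j,\mathbf t):\mathbf X\to\mathbf Y$ and $(i,\mathbf s):\mathbf Y\to\mathbf Z$: $(i,\mathbf s)\circ(j,\mathbf t)=(\langle j,i\rangle,[\mathbf s_k*\mathbf t_k]_k)$ (well defined on classes). -}

module Defs where

open import Data.Nat.Base using (ℕ; zero; suc; _≤_)
open import Data.Product.Base using (_×_; _,_; proj₁; proj₂)
open import Data.Unit.Polymorphic.Base using (⊤; tt)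
open import Function.Base using (const)
open import Level using (Level) renaming (suc to lsuc)
open import Relation.Binary.Bundles using (Setoid)
open import Relation.Binary.PropositionalEquality
  using (_≡_; _≗_; refl; sym; trans)

private
  variable
    ℓ : Level

-- The cartesian category is Set ℓ: objects are types in a fixed universe,
-- morphisms are functions, and equality of morphisms is pointwise.

! : {X : Set ℓ} → X → ⊤ {ℓ}
! = const tt

-- A 2-cell with prv = S, dom = X, nxt = S′, cod = Y.
record Cell (S X S′ Y : Set ℓ) : Set ℓ where
  constructor cell
  field
    U : S × X → S′ × Y

open Cell public

infixl 6 _⨾_

_⨾_ : {S S′ S″ X Y V W : Set ℓ} →
      Cell S X S′ Y → Cell S′ V S″ W → Cell S (X × V) S″ (Y × W)
U (f ⨾ h) (s , x , v) =
  let (s′ , y) = U f (s , x)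
      (s″ , w) = U h (s′ , v)
  in s″ , y , w

infix 8 _ᵛ

-- Products are not strictly unital here, so φ is composed with X × 1 ≅ X
-- and Y ≅ Y × 1.
_ᵛ : {X Y : Set ℓ} → (X → Y) → Cell X ⊤ Y ⊤
U (φ ᵛ) (x , _) = φ x , tt

-- ∏< X n is X 0 × ⋯ × X (n - 1), bracketed to the left as
-- ((1 × X 0) × ⋯) × X (n - 1).
∏< : (ℕ → Set ℓ) → ℕ → Set ℓ
∏< X zero    = ⊤
∏< X (suc n) = ∏< X n × X n

-- The condition nxt sₖ = prv sₖ₊₁ is built in by indexing the cells over a
-- single sequence of state types, with state k = prv sₖ.
record StatefulSequence (X Y : ℕ → Set ℓ) : Set (lsuc ℓ) where
  field
    state : ℕ → Set ℓ
    init  : ⊤ {ℓ} → state 0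
    cells : (k : ℕ) → Cell (state k) (X k) (state (suc k)) (Y k)

  -- init ᵛ ⨾ s₀ ⨾ ⋯ ⨾ sₙ₋₁
  composite : (n : ℕ) → Cell ⊤ (∏< X n) (state n) (∏< Y n)
  composite zero    = init ᵛ
  composite (suc n) = composite n ⨾ cells n

  -- The underlying morphism has type 1 × (∏ × 1) → 1 × (∏ × 1); it is
  -- conjugated by the unit isomorphisms, which are identities in the strict
  -- setting.
  Tc : (n : ℕ) → ∏< X (suc n) → ∏< Y (suc n)
  Tc n xs = proj₁ (proj₂ (U (composite (suc n) ⨾ ! ᵛ) (tt , xs , tt)))

open StatefulSequence public using (Tc)

-- The homset of St(Set): extensional equivalence classes are represented by
-- a setoid.
St : (X Y : ℕ → Set ℓ) → Setoid (lsuc ℓ) ℓ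
St X Y = record
  { Carrier       = StatefulSequence X Y
  ; _≈_           = λ s t → ∀ n → Tc s n ≗ Tc t n
  ; isEquivalence = record
    { refl  = λ n xs → refl
    ; sym   = λ p n xs → sym (p n xs)
    ; trans = λ p q n xs → trans (p n xs) (q n xs)
    }
  }

[_] : Set ℓ → ℕ → Set ℓ
[ A ] = const A

infix 4 _≡[_]_

_≡[_]_ : {A : Set ℓ} → (ℕ → A) → ℕ → (ℕ → A) → Set ℓ
x ≡[ n ] y = ∀ i → i ≤ n → x i ≡ y i

Causal : {A B : Set ℓ} → ((ℕ → A) → (ℕ → B)) → Set ℓ
Causal f = ∀ x y n → x ≡[ n ] y → f x ≡[ n ] f y

record CausalFunction (A B : Set ℓ) : Set ℓ where
  field
    fun    : (ℕ → A) → (ℕ → B)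
    causal : Causal fun

open CausalFunction public

-- Two causal functions are identified when they have the same values; the
-- causality proofs are irrelevant.  Causality already makes fun respect
-- pointwise equality of sequences.
CausalFunctions : (A B : Set ℓ) → Setoid ℓ ℓ
CausalFunctions A B = record
  { Carrier       = CausalFunction A B
  ; _≈_           = λ f g → ∀ x → fun f x ≗ fun g x
  ; isEquivalence = record
    { refl  = λ x n → refl
    ; sym   = λ p x n → sym (p x n)
    ; trans = λ p q x n → trans (p x n) (q x n)
    }
  }

{-# OPTIONS --safe #-}
-- The n-th output of a causal function depends only on the first n + 1 inputs,
-- so a causal function is the same thing as the family of last components of
-- the truncations.  Truncations are determined by their last components, hence
-- injectivity; a causal function is realised by the sequence whose k-th state
-- is the list of the k inputs read so far.
module Submission where

open import Level using (Level)
open import Data.Nat.Base using (ℕ; zero; suc; _+_; _<_; s≤s)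
open import Data.Nat.Properties
  using (≤-refl; ≤-trans; ≤-pred; +-identityʳ; +-suc; n<1+n; m<n⇒m<1+n; m<1+n⇒m<n∨m≡n)
open import Data.Product.Base using (_,_; proj₁; proj₂)
open import Data.Sum.Base using (inj₁; inj₂)
open import Data.Unit.Polymorphic.Base using (tt)
open import Function.Base using (const; id)
open import Function.Bundles using (Bijection)
open import Relation.Binary.PropositionalEquality
  using (_≡_; _≗_; refl; sym; trans; cong; cong₂; subst)
open import Defs

open StatefulSequence using (composite)

private
  variable
    ℓ : Level
    A B : Set ℓ

take : ∀ n → (ℕ → A) → ∏< [ A ] n
take zero    x = tt
take (suc n) x = take n x , x n

take-cong : ∀ n {x y : ℕ → A} → (∀ i → i < n → x i ≡ y i) → take n x ≡ take n y
take-cong zero    eq = refl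
take-cong (suc n) eq =
  cong₂ _,_ (take-cong n (λ i i<n → eq i (m<n⇒m<1+n i<n))) (eq n (n<1+n n))

take-injective : ∀ n {x y : ℕ → A} → take n x ≡ take n y → ∀ i → i < n → x i ≡ y i
take-injective (suc n) eq i i<1+n with m<1+n⇒m<n∨m≡n i<1+n
... | inj₁ i<n  = take-injective n (cong proj₁ eq) i i<n
... | inj₂ refl = cong proj₂ eq

cons : A → (ℕ → A) → ℕ → A
cons a x zero    = a
cons a x (suc i) = x i

append : ∀ n → ∏< [ A ] n → (ℕ → A) → ℕ → A
append zero    _       x = x
append (suc n) (p , a) x = append n p (cons a x)

-- The last entry of the list moves onto the tail and shifts its indices by one, so the induction
-- needs arbitrary `x` and `i`.
append-+ : ∀ n (p : ∏< [ A ] n) x i → append n p x (n + i) ≡ x i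
append-+ zero    p       x i = refl
append-+ (suc n) (p , a) x i =
  trans (cong (append n p (cons a x)) (sym (+-suc n i))) (append-+ n p (cons a x) (suc i))

take-append : ∀ n (p : ∏< [ A ] n) x → take n (append n p x) ≡ p
take-append zero    p       x = refl
take-append (suc n) (p , a) x = cong₂ _,_ (take-append n p (cons a x))
  -- `a` heads the tail `cons a x`, hence sits at position `n + 0`.
  (trans (cong (append n p (cons a x)) (sym (+-identityʳ n))) (append-+ n p (cons a x) 0))

-- Repeating the last entry makes an infinite extension available without
-- assuming that A is inhabited.
extend : ∀ n → ∏< [ A ] (suc n) → ℕ → A
extend n (p , a) = append (suc n) (p , a) (const a)

take-extend : ∀ n (p : ∏< [ A ] (suc n)) → take (suc n) (extend n p) ≡ p
take-extend n (p , a) = take-append (suc n) (p , a) (const a)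

extend-take : ∀ n (x : ℕ → A) → extend n (take (suc n) x) ≡[ n ] x
extend-take n x i i≤n = take-injective (suc n) (take-extend n (take (suc n) x)) i (s≤s i≤n)

output : {X Y : ℕ → Set ℓ} → StatefulSequence X Y → ∀ n → ∏< X (suc n) → Y n
output s n xs = proj₂ (Tc s n xs)

-- Later cells leave earlier outputs unchanged, so each step only adds a last component. States are
-- not compared, since `s` and `t` may have different state types.
composite-ext : {X Y : ℕ → Set ℓ} (s t : StatefulSequence X Y) →
                (∀ n → output s n ≗ output t n) →
                ∀ n xs → proj₂ (U (composite s n) (tt , xs)) ≡ proj₂ (U (composite t n) (tt , xs))
composite-ext s t eq zero    xs       = refl
composite-ext s t eq (suc n) (xs , x) = cong₂ _,_ (composite-ext s t eq n xs) (eq n (xs , x))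

Tc-ext : {X Y : ℕ → Set ℓ} (s t : StatefulSequence X Y) →
         (∀ n → output s n ≗ output t n) → ∀ n → Tc s n ≗ Tc t n
Tc-ext s t eq n = composite-ext s t eq (suc n)

toCausal : StatefulSequence [ A ] [ B ] → CausalFunction A B
toCausal s = record
  { fun    = λ x n → output s n (take (suc n) x)
  ; causal = λ x y n x≡y i i≤n →
      cong (output s i) (take-cong (suc i) λ j j<1+i → x≡y j (≤-trans (≤-pred j<1+i) i≤n))
  }

toCausal-injective : (s t : StatefulSequence [ A ] [ B ]) →
                     (∀ x → fun (toCausal s) x ≗ fun (toCausal t) x) →
                     ∀ n → Tc s n ≗ Tc t n
toCausal-injective s t eq = Tc-ext s t λ n xs →
  -- Every `xs` is a prefix of the sequence `extend n xs`, so agreement on sequences covers all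
  -- finite inputs.
  subst (λ p → output s n p ≡ output t n p) (take-extend n xs) (eq (extend n xs) n)

fromCausal : CausalFunction A B → StatefulSequence [ A ] [ B ]
fromCausal {A = A} f = record
  { state = ∏< [ A ]
  ; init  = id
  -- The old state paired with the new input is by definition the next state; it has k + 1 entries,
  -- so `extend` applies.
  ; cells = λ k → cell λ p → p , fun f (extend k p) k
  }

fromCausal-state : (f : CausalFunction A B) → ∀ n xs →
                   proj₁ (U (composite (fromCausal f) n) (tt , xs)) ≡ xs
fromCausal-state f zero    xs       = refl
fromCausal-state f (suc n) (xs , x) = cong (_, x) (fromCausal-state f n xs)

toCausal-fromCausal : (f : CausalFunction A B) →
                      ∀ x → fun (toCausal (fromCausal f)) x ≗ fun f x
toCausal-fromCausal f x n = trans
  (cong (λ p → fun f (extend n p) n) (fromCausal-state f (suc n) (take (suc n) x)))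
  -- The extension may differ from `x` beyond index n, which causality ignores.
  (causal f (extend n (take (suc n) x)) x n (extend-take n x) n ≤-refl)

theorem14 : ∀ {ℓ : Level} (A B : Set ℓ) → Bijection (St [ A ] [ B ]) (CausalFunctions A B)
theorem14 A B = record
  { to        = toCausal
  ; cong      = λ s≈t x n → cong proj₂ (s≈t n (take (suc n) x))
  ; bijective =
      (λ {s} {t} → toCausal-injective s t) ,
      -- Surjectivity is required for every sequence equivalent to `fromCausal f`, hence the detour
      -- through `s≈`.
      (λ f → fromCausal f , λ s≈ x n →
        trans (cong proj₂ (s≈ n (take (suc n) x))) (toCausal-fromCausal f x n))
  }
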